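{- There is an absolute constant $\varepsilon>0$ such that for every positive integer $n$, $\mathrm{val}(\mathsf{GHZ}^{\otimes n})\leq 2^{ -\varepsilon n}$.
   Context: Let $S=\{(x,y,z)\in\{0,1\}^3 : x\oplus y\oplus z=0\}$. In the $n$-fold repeated GHZ game $\mathsf{GHZ}^{\otimes n}$, a verifier samples $(x_i,y_i,z_i)$ independently and uniformly from $S$ for $i=1,\ldots,n$, sends $\vec x=(x_1,\ldots,x_n)$ to Alice, $\vec y=(y_1,\ldots,y_n)$ to Bob and $\vec z=(z_1,\ldots,z_n)$ to Charlie. The players answer according to functions $f,g,h\colon\{0,1\}^n\to\{0,1\}^n$ (answers $f(\vec x)$, $g(\vec y)$, $h(\vec z)$), and the verifier accepts iff $f(\vec x)_i\oplus g(\vec y)_i\oplus h(\vec z)_i = x_i\lor y_i\lor z_i$ for all $i=1,\ldots,n$. The value $\mathrm{val}(\mathsf{GHZ}^{\otimes n})$ is the maximum, over all choices of $f,g,h$, of the acceptance probability. -}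

module Defs where

open import Data.Bool using (Bool; true; false; _xor_; _∨_; _∧_; if_then_else_)
open import Data.Bool.Properties using ()
open import Data.Nat using (ℕ; zero; suc; _+_)
open import Data.List using (List; []; _∷_; map; concatMap)
open import Data.Nat.ListAction using (sum)
open import Data.Vec using (Vec; []; _∷_; zipWith)

allVecs : (n : ℕ) → List (Vec Bool n)
allVecs zero    = [] ∷ []
allVecs (suc n) = concatMap (λ v → (false ∷ v) ∷ (true ∷ v) ∷ []) (allVecs n)

_==ᵇ_ : Bool → Bool → Bool
a ==ᵇ b = (a xor b) xor true

allᵛ : {n : ℕ} → Vec Bool n → Bool
allᵛ []       = true
allᵛ (b ∷ bs) = b ∧ allᵛ bs

winCoord : Bool → Bool → Bool → Bool → Bool → Bool → Bool
winCoord x y z a b c = ((a xor b) xor c) ==ᵇ ((x ∨ y) ∨ z)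

winAll : {n : ℕ} → (x y z a b c : Vec Bool n) → Bool
winAll []       []       []       []       []       []       = true
winAll (x ∷ xs) (y ∷ ys) (z ∷ zs) (a ∷ as) (b ∷ bs) (c ∷ cs) =
  winCoord x y z a b c ∧ winAll xs ys zs as bs cs

xorᵛ : {n : ℕ} → Vec Bool n → Vec Bool n → Vec Bool n
xorᵛ = zipWith _xor_

Strategy : ℕ → Set
Strategy n = Vec Bool n → Vec Bool n

-- Number of question triples (x,y,z) ∈ S^n (z = x ⊕ y coordinatewise; there are 4^n
-- of them, each with probability 4^{-n}) on which the verifier accepts.
-- Hence the acceptance probability of (f,g,h) is  winCount n f g h / 4^n.
winCount : (n : ℕ) → Strategy n → Strategy n → Strategy n → ℕ
winCount n f g h =
  sum (concatMap (λ x → map (λ y →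
         let z = xorᵛ x y in
         if winAll x y z (f x) (g y) (h z) then 1 else 0) (allVecs n)) (allVecs n))

{-# OPTIONS --safe #-}
module Submission where

-- Encode a question x with its answer a as the vector x + 2a over ℤ/4, giving F, G, H.
-- The players win on (x , y , z) iff F x + G y + H z = 0, because 2 (x ∨ y ∨ z) = x + y + z
-- in ℤ whenever x ⊕ y ⊕ z = 0. The image of F meets every coset of 2 (ℤ/4)ⁿ once, so
-- F x + 2 F y determines both x and y: it takes N² values, N = 2ⁿ. Many winning questions
-- would force it to take few values, as in the Balog–Szemerédi–Gowers theorem.
--
-- For fixed z let A be the set of x such that (x , x ⊕ z , z) is won, and let k(x , x′) be the
-- number of pairs (p , q) with F p − G q = F x − G (x′ ⊕ z). Recovering points from F x + 2 F y
-- shows that k(x₁ , x₂) k(x₁ , x₃) k(x₂ , x₃) sums to at most N⁵ over A³, whereas 1 / k(x₁ , x₂)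
-- sums to at most N² over A² and all z. AM–GM, applied to the three factors and their
-- reciprocals, then bounds the sum of |A|³ over z by N^(15/4), and the power mean inequality
-- bounds the number of won questions.

open import Defs
open import Algebra.Bundles using (AbelianGroup)
import Algebra.Consequences.Setoid as Consequences
open import Data.Bool using (Bool; true; false; _xor_; _∧_; if_then_else_; T; T?)
open import Data.Bool.Properties using (T-∧; ∧-idem; xor-assoc; xor-same; xor-identityʳ)
import Data.Bool.Properties as Bool
open import Data.Empty using (⊥-elim)
open import Data.List using (List; []; _∷_; _++_; map; concatMap; cartesianProduct; length)
open import Data.List.Membership.Propositional using (_∈_)
open import Data.List.Membership.Propositional.Properties
  using (∈-∃++; ∈-++⁺ˡ; ∈-++⁺ʳ; ∈-++⁻; ∈-concatMap⁺; ∈-cartesianProduct⁺)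
open import Data.List.Properties using (map-cong; map-++; map-∘; length-++; length-map)
open import Data.List.Relation.Binary.Disjoint.Propositional using (Disjoint)
open import Data.List.Relation.Unary.All using ([]; _∷_)
import Data.List.Relation.Unary.All as All
import Data.List.Relation.Unary.All.Properties as All
open import Data.List.Relation.Unary.AllPairs using ([]; _∷_)
import Data.List.Relation.Unary.AllPairs as AllPairs
import Data.List.Relation.Unary.AllPairs.Properties as AllPairs
open import Data.List.Relation.Unary.Any using (here; there)
import Data.List.Relation.Unary.Any as Any
open import Data.List.Relation.Unary.Unique.Propositional using (Unique)
import Data.List.Relation.Unary.Unique.Propositional.Properties as Unique
open import Data.Nat using (ℕ; zero; suc; _+_; _*_; _^_; _!; _≤_; _<_; _≥_; z≤n; s≤s; NonZero; _/_; _%_)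
open import Data.Nat.DivMod using (m≡m%n+[m/n]*n; m%n<n)
open import Data.Nat.Divisibility using (_∣_; quotient; module _∣_; m∣m*n; ∣-trans; m≤n⇒m!∣n!)
open import Data.Nat.ListAction using (sum)
open import Data.Nat.ListAction.Properties using (sum-++)
open import Data.Nat.Properties
open import Data.Nat.Solver using (module +-*-Solver)
open import Data.Nat.Tactic.RingSolver using (solve-∀)
open import Data.Product using (∃-syntax; _×_; _,_; proj₁; proj₂)
open import Data.Product.Properties using (,-injective)
import Data.Product.Properties as Product
open import Data.Sum using (inj₁; inj₂)
open import Data.Vec using (Vec; []; _∷_; zip; zipWith)
import Data.Vec as Vec
import Data.Vec.Properties as Vec
open import Function using (_∘_; Equivalence)
open import Relation.Binary.PropositionalEquality
open import Relation.Binary.PropositionalEquality.Algebra using (isMagma)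
open import Relation.Nullary using (Dec; yes; no; does; contradiction)
open import Relation.Nullary.Decidable using (_→-dec_; from-yes)
open +-*-Solver using (solve; _:=_; _:*_; _:+_; _:^_; con)

private variable
  A B : Set

-- Finite sums over lists.

∑ : List A → (A → ℕ) → ℕ
∑ xs f = sum (map f xs)

∑-cong : ∀ (xs : List A) {f g : A → ℕ} → (∀ x → f x ≡ g x) → ∑ xs f ≡ ∑ xs g
∑-cong xs f≡g = cong sum (map-cong f≡g xs)

∑-mono : ∀ (xs : List A) {f g : A → ℕ} → (∀ x → f x ≤ g x) → ∑ xs f ≤ ∑ xs g
∑-mono []       f≤g = z≤n
∑-mono (x ∷ xs) f≤g = +-mono-≤ (f≤g x) (∑-mono xs f≤g)

∑-++ : ∀ (xs ys : List A) (f : A → ℕ) → ∑ (xs ++ ys) f ≡ ∑ xs f + ∑ ys f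
∑-++ xs ys f = trans (cong sum (map-++ f xs ys)) (sum-++ (map f xs) (map f ys))

∑-distrib-+ : ∀ (xs : List A) (f g : A → ℕ) → ∑ xs (λ x → f x + g x) ≡ ∑ xs f + ∑ xs g
∑-distrib-+ []       f g = refl
∑-distrib-+ (x ∷ xs) f g = trans (cong (f x + g x +_) (∑-distrib-+ xs f g))
  (interchange (f x) (g x) (∑ xs f) (∑ xs g))
  where
  interchange : ∀ a b c d → a + b + (c + d) ≡ a + c + (b + d)
  interchange = solve-∀

*-distribˡ-∑ : ∀ c (xs : List A) (f : A → ℕ) → c * ∑ xs f ≡ ∑ xs (λ x → c * f x)
*-distribˡ-∑ c []       f = *-zeroʳ c
*-distribˡ-∑ c (x ∷ xs) f =
  trans (*-distribˡ-+ c (f x) (∑ xs f)) (cong (c * f x +_) (*-distribˡ-∑ c xs f))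

*-distribʳ-∑ : ∀ c (xs : List A) (f : A → ℕ) → ∑ xs f * c ≡ ∑ xs (λ x → f x * c)
*-distribʳ-∑ c []       f = refl
*-distribʳ-∑ c (x ∷ xs) f =
  trans (*-distribʳ-+ c (f x) (∑ xs f)) (cong (f x * c +_) (*-distribʳ-∑ c xs f))

∑-const : ∀ (xs : List A) c → ∑ xs (λ _ → c) ≡ length xs * c
∑-const []       c = refl
∑-const (_ ∷ xs) c = cong (c +_) (∑-const xs c)

∑-cartesianProduct : ∀ (xs : List A) (ys : List B) (f : A × B → ℕ) →
                     ∑ (cartesianProduct xs ys) f ≡ ∑ xs (λ x → ∑ ys (λ y → f (x , y)))
∑-cartesianProduct []       ys f = refl
∑-cartesianProduct (x ∷ xs) ys f = trans (∑-++ (map (x ,_) ys) (cartesianProduct xs ys) f)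
  (cong₂ _+_ (cong sum (sym (map-∘ ys))) (∑-cartesianProduct xs ys f))

∑-*-∑ : ∀ (xs : List A) (ys : List B) (f : A → ℕ) (g : B → ℕ) →
        ∑ xs f * ∑ ys g ≡ ∑ (cartesianProduct xs ys) (λ (x , y) → f x * g y)
∑-*-∑ xs ys f g = trans (*-distribʳ-∑ (∑ ys g) xs f)
  (trans (∑-cong xs (λ x → *-distribˡ-∑ (f x) ys g)) (sym (∑-cartesianProduct xs ys _)))

length-cartesianProduct : ∀ (xs : List A) (ys : List B) →
                          length (cartesianProduct xs ys) ≡ length xs * length ys
length-cartesianProduct []       ys = refl
length-cartesianProduct (x ∷ xs) ys = trans (length-++ (map (x ,_) ys))
  (cong₂ _+_ (length-map (x ,_) ys) (length-cartesianProduct xs ys))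

-- Only the support of f has to be mapped injectively.
∑-injection : ∀ {xs : List A} {ys : List B} {f : A → ℕ} {g : B → ℕ} (φ : A → B) →
              Unique xs →
              (∀ x → f x ≢ 0 → φ x ∈ ys × f x ≤ g (φ x)) →
              (∀ x y → f x ≢ 0 → f y ≢ 0 → φ x ≡ φ y → x ≡ y) →
              ∑ xs f ≤ ∑ ys g
∑-injection {A = A} {B} {ys = ys₀} {f} {g} φ uniq into inj =
  go _ ys₀ uniq (λ x _ fx → proj₁ (into x fx))
  where
  open ≤-Reasoning
  go : ∀ xs ys → Unique xs → (∀ x → x ∈ xs → f x ≢ 0 → φ x ∈ ys) → ∑ xs f ≤ ∑ ys g
  go []       ys _        _  = z≤n
  go (x ∷ xs) ys (x∉ ∷ u) ∈ys with f x ≟ 0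
  ... | yes fx≡0 = subst (λ k → k + ∑ xs f ≤ ∑ ys g) (sym fx≡0) (go xs ys u (λ y → ∈ys y ∘ there))
  -- One occurrence of `φ x` is removed from `ys`; by injectivity the later images differ from it,
  -- so they still lie in what remains.
  ... | no fx≢0 with ∈-∃++ (∈ys x (here refl) fx≢0)
  ...   | ys₁ , ys₂ , refl = begin
    f x + ∑ xs f                   ≤⟨ +-mono-≤ (proj₂ (into x fx≢0)) (go xs (ys₁ ++ ys₂) u ∈rest) ⟩
    g (φ x) + ∑ (ys₁ ++ ys₂) g     ≡⟨ cong (g (φ x) +_) (∑-++ ys₁ ys₂ g) ⟩
    g (φ x) + (∑ ys₁ g + ∑ ys₂ g)  ≡⟨ rotate (g (φ x)) (∑ ys₁ g) (∑ ys₂ g) ⟩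
    ∑ ys₁ g + (g (φ x) + ∑ ys₂ g)  ≡⟨ ∑-++ ys₁ (φ x ∷ ys₂) g ⟨
    ∑ (ys₁ ++ φ x ∷ ys₂) g         ∎
    where
    rotate : ∀ a b c → a + (b + c) ≡ b + (a + c)
    rotate = solve-∀
    ∈rest : ∀ y → y ∈ xs → f y ≢ 0 → φ y ∈ ys₁ ++ ys₂
    ∈rest y y∈ fy≢0 with ∈-++⁻ ys₁ (∈ys y (there y∈) fy≢0)
    ... | inj₁ φy∈          = ∈-++⁺ˡ φy∈
    ... | inj₂ (there φy∈)  = ∈-++⁺ʳ ys₁ φy∈
    ... | inj₂ (here φy≡φx) = ⊥-elim (All.lookup x∉ y∈ (inj x y fx≢0 fy≢0 (sym φy≡φx)))

-- Quadratic inequalities, AM-GM and power means.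

-- In place of a signed difference, the larger number is the smaller plus `d`; the gap between the
-- two sides is then `d * d`.
4xy≤[x+y]² : ∀ x y → 4 * (x * y) ≤ (x + y) ^ 2
4xy≤[x+y]² x y with ≤-total x y
... | inj₁ x≤y with m≤n⇒∃[o]m+o≡n x≤y
...   | d , refl = subst (4 * (x * (x + d)) ≤_) (square x d) (m≤m+n _ (d * d))
  where
  square : ∀ x d → 4 * (x * (x + d)) + d * d ≡ (x + (x + d)) ^ 2
  square = solve 2 (λ x d → con 4 :* (x :* (x :+ d)) :+ d :* d := (x :+ (x :+ d)) :^ 2) refl
4xy≤[x+y]² x y | inj₂ y≤x with m≤n⇒∃[o]m+o≡n y≤x
...   | d , refl = subst (4 * ((y + d) * y) ≤_) (square y d) (m≤m+n _ (d * d))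
  where
  square : ∀ y d → 4 * ((y + d) * y) + d * d ≡ (y + d + y) ^ 2
  square = solve 2 (λ y d → con 4 :* ((y :+ d) :* y) :+ d :* d := (y :+ d :+ y) :^ 2) refl

2xy≤x²+y² : ∀ x y → 2 * (x * y) ≤ x ^ 2 + y ^ 2
2xy≤x²+y² x y = +-cancelˡ-≤ (2 * (x * y)) _ _
  (subst₂ _≤_ (lhs x y) (rhs x y) (4xy≤[x+y]² x y))
  where
  lhs : ∀ x y → 4 * (x * y) ≡ 2 * (x * y) + 2 * (x * y)
  lhs = solve-∀
  rhs : ∀ x y → (x + y) ^ 2 ≡ 2 * (x * y) + (x ^ 2 + y ^ 2)
  rhs = solve 2 (λ x y → (x :+ y) :^ 2 := con 2 :* (x :* y) :+ (x :^ 2 :+ y :^ 2)) refl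

^-cancelˡ-≤ : ∀ n .{{_ : NonZero n}} {x y} → x ^ n ≤ y ^ n → x ≤ y
^-cancelˡ-≤ n {x} {y} xⁿ≤yⁿ with x ≤? y
... | yes x≤y = x≤y
... | no  x≰y = contradiction xⁿ≤yⁿ (<⇒≱ (^-monoˡ-< n (≰⇒> x≰y)))

^-distribʳ-* : ∀ n x y → (x * y) ^ n ≡ x ^ n * y ^ n
^-distribʳ-* zero    x y = refl
^-distribʳ-* (suc n) x y =
  trans (cong (x * y *_) (^-distribʳ-* n x y)) (interchange x y (x ^ n) (y ^ n))
  where
  interchange : ∀ x y u v → x * y * (u * v) ≡ x * u * (y * v)
  interchange = solve-∀

-- Two-variable AM-GM on each half, then on the two half sums.
256wxyz≤[w+x+y+z]⁴ : ∀ w x y z → 256 * (w * x * (y * z)) ≤ (w + x + (y + z)) ^ 4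
256wxyz≤[w+x+y+z]⁴ w x y z = begin
  256 * (w * x * (y * z))                    ≡⟨ regroup (w * x) (y * z) ⟩
  16 * (4 * (w * x) * (4 * (y * z)))         ≤⟨ *-monoʳ-≤ 16 (*-mono-≤ (4xy≤[x+y]² w x) (4xy≤[x+y]² y z)) ⟩
  16 * ((w + x) ^ 2 * (y + z) ^ 2)           ≡⟨ square (w + x) (y + z) ⟩
  (4 * ((w + x) * (y + z))) ^ 2              ≤⟨ ^-monoˡ-≤ 2 (4xy≤[x+y]² (w + x) (y + z)) ⟩
  ((w + x + (y + z)) ^ 2) ^ 2                ≡⟨ ^-*-assoc (w + x + (y + z)) 2 2 ⟩
  (w + x + (y + z)) ^ 4                      ∎
  where
  open ≤-Reasoning
  regroup : ∀ p q → 256 * (p * q) ≡ 16 * (4 * p * (4 * q))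
  regroup = solve-∀
  square : ∀ p q → 16 * (p ^ 2 * q ^ 2) ≡ (4 * (p * q)) ^ 2
  square = solve 2 (λ p q → con 16 :* (p :^ 2 :* q :^ 2) := (con 4 :* (p :* q)) :^ 2) refl

-- AM-GM for `u * (v * w) * D`, `c ^ 4 * a`, `c ^ 4 * b` and `c ^ 4 * e`. Their product is
-- `(c ^ 3 * D) ^ 4`, because `a`, `b`, `e` are the reciprocals of `u`, `v`, `w` scaled by `D`. The
-- free `c` serves to balance the two terms later.
amgm-reciprocals : ∀ c D u v w a b e → u * a ≡ D → v * b ≡ D → w * e ≡ D →
                   4 * (c ^ 3 * D) ≤ u * (v * w) * D + c ^ 4 * (a + (b + e))
amgm-reciprocals c D u v w a b e ua≡D vb≡D we≡D = ^-cancelˡ-≤ 4 (begin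
  (4 * (c ^ 3 * D)) ^ 4
    ≡⟨ expand c D ⟩
  256 * (c ^ 12 * D * (D * (D * D)))
    ≡⟨ cong (λ t → 256 * (c ^ 12 * D * t)) (cong₂ _*_ ua≡D (cong₂ _*_ vb≡D we≡D)) ⟨
  256 * (c ^ 12 * D * (u * a * (v * b * (w * e))))
    ≡⟨ regroup (c ^ 4) (c ^ 12) D u v w a b e (sym (^-*-assoc c 4 3)) ⟩
  256 * (u * (v * w) * D * (c ^ 4 * a) * (c ^ 4 * b * (c ^ 4 * e)))
    ≤⟨ 256wxyz≤[w+x+y+z]⁴ (u * (v * w) * D) (c ^ 4 * a) (c ^ 4 * b) (c ^ 4 * e) ⟩
  (u * (v * w) * D + c ^ 4 * a + (c ^ 4 * b + c ^ 4 * e)) ^ 4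
    ≡⟨ cong (_^ 4) (collect (u * (v * w) * D) (c ^ 4) a b e) ⟩
  (u * (v * w) * D + c ^ 4 * (a + (b + e))) ^ 4 ∎)
  where
  open ≤-Reasoning
  expand : ∀ c D → (4 * (c ^ 3 * D)) ^ 4 ≡ 256 * (c ^ 12 * D * (D * (D * D)))
  expand = solve 2 (λ c D →
    (con 4 :* (c :^ 3 :* D)) :^ 4 := con 256 :* (c :^ 12 :* D :* (D :* (D :* D)))) refl
  collect : ∀ x k a b e → x + k * a + (k * b + k * e) ≡ x + k * (a + (b + e))
  collect = solve-∀
  regroup′ : ∀ k D u v w a b e → 256 * (k ^ 3 * D * (u * a * (v * b * (w * e))))
             ≡ 256 * (u * (v * w) * D * (k * a) * (k * b * (k * e)))
  regroup′ = solve 8 (λ k D u v w a b e →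
    con 256 :* (k :^ 3 :* D :* (u :* a :* (v :* b :* (w :* e))))
    := con 256 :* (u :* (v :* w) :* D :* (k :* a) :* (k :* b :* (k :* e)))) refl
  regroup : ∀ k l D u v w a b e → l ≡ k ^ 3 → 256 * (l * D * (u * a * (v * b * (w * e))))
             ≡ 256 * (u * (v * w) * D * (k * a) * (k * b * (k * e)))
  regroup k l D u v w a b e refl = regroup′ k D u v w a b e

-- Cauchy-Schwarz against the constant 1, by summing `2xy≤x²+y²` over all pairs of entries.
∑²≤length*∑² : ∀ (xs : List A) (f : A → ℕ) → ∑ xs f ^ 2 ≤ length xs * ∑ xs (λ x → f x ^ 2)
∑²≤length*∑² xs f = *-cancelˡ-≤ 2 (begin
  2 * ∑ xs f ^ 2
    ≡⟨ cong (2 *_) (trans (square (∑ xs f)) (∑-*-∑ xs xs f f)) ⟩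
  2 * ∑ xs² (λ (x , y) → f x * f y)
    ≡⟨ *-distribˡ-∑ 2 xs² _ ⟩
  ∑ xs² (λ (x , y) → 2 * (f x * f y))
    ≤⟨ ∑-mono xs² (λ (x , y) → 2xy≤x²+y² (f x) (f y)) ⟩
  ∑ xs² (λ (x , y) → f x ^ 2 + f y ^ 2)
    ≡⟨ ∑-cartesianProduct xs xs _ ⟩
  ∑ xs (λ x → ∑ xs (λ y → f x ^ 2 + f y ^ 2))
    ≡⟨ ∑-cong xs (λ x → trans (∑-distrib-+ xs _ _) (cong (_+ S) (∑-const xs (f x ^ 2)))) ⟩
  ∑ xs (λ x → length xs * f x ^ 2 + S)
    ≡⟨ ∑-distrib-+ xs _ _ ⟩
  ∑ xs (λ x → length xs * f x ^ 2) + ∑ xs (λ _ → S)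
    ≡⟨ cong₂ _+_ (sym (*-distribˡ-∑ (length xs) xs _)) (∑-const xs S) ⟩
  length xs * S + length xs * S
    ≡⟨ double (length xs * S) ⟩
  2 * (length xs * S) ∎)
  where
  open ≤-Reasoning
  xs² = cartesianProduct xs xs
  S = ∑ xs (λ x → f x ^ 2)
  square : ∀ s → s ^ 2 ≡ s * s
  square = solve 1 (λ s → s :^ 2 := s :* s) refl
  double : ∀ s → s + s ≡ 2 * s
  double = solve-∀

∑⁴≤length³*∑⁴ : ∀ (xs : List A) (f : A → ℕ) →
                ∑ xs f ^ 4 ≤ length xs ^ 3 * ∑ xs (λ x → f x ^ 4)
∑⁴≤length³*∑⁴ xs f = begin
  ∑ xs f ^ 4
    ≡⟨ ^-*-assoc (∑ xs f) 2 2 ⟨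
  (∑ xs f ^ 2) ^ 2
    ≤⟨ ^-monoˡ-≤ 2 (∑²≤length*∑² xs f) ⟩
  (ℓ * ∑ xs (λ x → f x ^ 2)) ^ 2
    ≡⟨ expand ℓ (∑ xs (λ x → f x ^ 2)) ⟩
  ℓ ^ 2 * ∑ xs (λ x → f x ^ 2) ^ 2
    ≤⟨ *-monoʳ-≤ (ℓ ^ 2) (∑²≤length*∑² xs (λ x → f x ^ 2)) ⟩
  ℓ ^ 2 * (ℓ * ∑ xs (λ x → (f x ^ 2) ^ 2))
    ≡⟨ collect ℓ (∑ xs (λ x → (f x ^ 2) ^ 2)) ⟩
  ℓ ^ 3 * ∑ xs (λ x → (f x ^ 2) ^ 2)
    ≡⟨ cong (ℓ ^ 3 *_) (∑-cong xs (λ x → ^-*-assoc (f x) 2 2)) ⟩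
  ℓ ^ 3 * ∑ xs (λ x → f x ^ 4) ∎
  where
  open ≤-Reasoning
  ℓ = length xs
  expand : ∀ ℓ s → (ℓ * s) ^ 2 ≡ ℓ ^ 2 * s ^ 2
  expand = solve 2 (λ ℓ s → (ℓ :* s) :^ 2 := ℓ :^ 2 :* s :^ 2) refl
  collect : ∀ ℓ s → ℓ ^ 2 * (ℓ * s) ≡ ℓ ^ 3 * s
  collect = solve 2 (λ ℓ s → ℓ :^ 2 :* (ℓ :* s) := ℓ :^ 3 :* s) refl

-- Extracting an exponential rate.

-- In terms of `N` the first hypothesis says `w ≤ N ^ (2 - 1/16)` up to constants. The ninth power
-- spends this gain: `m ^ 5` is left to spare after multiplying by `m ^ 4`, and 9 is the least
-- exponent at which the constants of `residue-bound` are absorbed for all of `a = 1, 2, 4, 8`.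
ninth-power-bound : ∀ k κ a m w .{{_ : NonZero k}} .{{_ : NonZero m}} → let N = a * m ^ 4 in
                    k * w ^ 4 ≤ m ^ 31 * κ → κ ^ 9 * a ≤ k ^ 9 * a ^ 72 → w ^ 36 * N ≤ N ^ 72
ninth-power-bound k κ a m w kw⁴≤m³¹κ κ⁹a≤k⁹a⁷² = *-cancelˡ-≤ (k ^ 9) {{m^n≢0 k 9}} (begin
  k ^ 9 * (w ^ 36 * N)
    ≡⟨ cong (λ t → k ^ 9 * (t * N)) (^-*-assoc w 4 9) ⟨
  k ^ 9 * ((w ^ 4) ^ 9 * N)
    ≡⟨ *-assoc (k ^ 9) ((w ^ 4) ^ 9) N ⟨
  k ^ 9 * (w ^ 4) ^ 9 * N
    ≡⟨ cong (_* N) (^-distribʳ-* 9 k (w ^ 4)) ⟨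
  (k * w ^ 4) ^ 9 * N
    ≤⟨ *-monoˡ-≤ N (^-monoˡ-≤ 9 kw⁴≤m³¹κ) ⟩
  (m ^ 31 * κ) ^ 9 * N
    ≡⟨ cong (_* N) (trans (^-distribʳ-* 9 (m ^ 31) κ) (cong (_* κ ^ 9) (^-*-assoc m 31 9))) ⟩
  m ^ 279 * κ ^ 9 * (a * m ^ 4)
    ≡⟨ shuffle (m ^ 279) (κ ^ 9) a (m ^ 4) ⟩
  m ^ 279 * m ^ 4 * (κ ^ 9 * a)
    ≤⟨ *-mono-≤ m²⁸³≤m²⁸⁸ κ⁹a≤k⁹a⁷² ⟩
  (m ^ 4) ^ 72 * (k ^ 9 * a ^ 72)
    ≡⟨ reassemble ((m ^ 4) ^ 72) (k ^ 9) (a ^ 72) ⟩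
  k ^ 9 * (a ^ 72 * (m ^ 4) ^ 72)
    ≡⟨ cong (k ^ 9 *_) (^-distribʳ-* 72 a (m ^ 4)) ⟨
  k ^ 9 * N ^ 72 ∎)
  where
  open ≤-Reasoning
  N = a * m ^ 4
  shuffle : ∀ p q a r → p * q * (a * r) ≡ p * r * (q * a)
  shuffle = solve-∀
  reassemble : ∀ p q r → p * (q * r) ≡ q * (r * p)
  reassemble = solve-∀
  m²⁸³≤m²⁸⁸ : m ^ 279 * m ^ 4 ≤ (m ^ 4) ^ 72
  m²⁸³≤m²⁸⁸ = begin
    m ^ 279 * m ^ 4  ≡⟨ ^-distribˡ-+-* m 279 4 ⟨
    m ^ 283          ≤⟨ ^-monoʳ-≤ m (≤ᵇ⇒≤ 283 288 _) ⟩
    m ^ 288          ≡⟨ ^-*-assoc m 4 72 ⟨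
    (m ^ 4) ^ 72     ∎

-- Taking c = N / m balances the two terms of the hypothesis up to the factor a, which is
-- the power of 2 left over when the exponent of N = 2 ^ n is divided by 4.
residue-bound : ∀ a m w .{{_ : NonZero a}} .{{_ : NonZero m}} → let N = a * m ^ 4 in
                (∀ c → 4 * (c ^ 3 * w ^ 4) ≤ N ^ 10 + 3 * c ^ 4 * N ^ 7) →
                (a ^ 7 + 3 * a ^ 8) ^ 9 * a ≤ 4 ^ 9 * a ^ 72 →
                w ^ 36 * N ≤ N ^ 72
residue-bound a m w bound = ninth-power-bound 4 (a ^ 7 + 3 * a ^ 8) a m w
  -- With `c = a * m ^ 3` both sides carry the factor `c ^ 3`; without it they read `4 * w ^ 4` and
  -- `m ^ 31 * (a ^ 7 + 3 * a ^ 8)`.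
  (*-cancelˡ-≤ (a ^ 3 * m ^ 9) {{m*n≢0 (a ^ 3) (m ^ 9) {{m^n≢0 a 3}} {{m^n≢0 m 9}}}}
    (subst₂ _≤_ (factor-left a m (w ^ 4)) (factor-right a m) (bound (a * m ^ 3))))
  where
  factor-left : ∀ a m s → 4 * ((a * m ^ 3) ^ 3 * s) ≡ a ^ 3 * m ^ 9 * (4 * s)
  factor-left = solve 3 (λ a m s → con 4 :* ((a :* m :^ 3) :^ 3 :* s)
    := a :^ 3 :* m :^ 9 :* (con 4 :* s)) refl
  factor-right : ∀ a m → (a * m ^ 4) ^ 10 + 3 * (a * m ^ 3) ^ 4 * (a * m ^ 4) ^ 7
                 ≡ a ^ 3 * m ^ 9 * (m ^ 31 * (a ^ 7 + 3 * a ^ 8))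
  factor-right = solve 2 (λ a m →
    (a :* m :^ 4) :^ 10 :+ con 3 :* (a :* m :^ 3) :^ 4 :* (a :* m :^ 4) :^ 7
    := a :^ 3 :* m :^ 9 :* (m :^ 31 :* (a :^ 7 :+ con 3 :* a :^ 8))) refl

-- The optimal `c` is `N ^ (3/4)` with `N = 2 ^ n`, which need not be an integer; writing `n` as
-- `r + 4 * (n / 4)` leaves four cases for `2 ^ r`.
exponential-decay : ∀ n w →
  (∀ c → 4 * (c ^ 3 * w ^ 4) ≤ (2 ^ n) ^ 10 + 3 * c ^ 4 * (2 ^ n) ^ 7) →
  w ^ 36 * 2 ^ (1 * n) ≤ 4 ^ (n * 36)
exponential-decay n w bound =
  subst₂ (λ k l → w ^ 36 * 2 ^ k ≤ l) (sym (*-identityˡ n)) (trans (^-*-assoc 2 n 72) 2^72n≡4^36n)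
    (subst (λ N → w ^ 36 * N ≤ N ^ 72) (sym 2ⁿ≡)
      (residue-bound (2 ^ r) m w {{m^n≢0 2 r}} {{m^n≢0 2 (n / 4)}}
        (λ c → subst (λ N → 4 * (c ^ 3 * w ^ 4) ≤ N ^ 10 + 3 * c ^ 4 * N ^ 7) 2ⁿ≡ (bound c))
        (residues r (m%n<n n 4))))
  where
  r = n % 4
  m = 2 ^ (n / 4)
  2ⁿ≡ : 2 ^ n ≡ 2 ^ r * m ^ 4
  2ⁿ≡ = trans (cong (2 ^_) (m≡m%n+[m/n]*n n 4))
    (trans (^-distribˡ-+-* 2 r (n / 4 * 4)) (cong (2 ^ r *_) (sym (^-*-assoc 2 (n / 4) 4))))
  2^72n≡4^36n : 2 ^ (n * 72) ≡ 4 ^ (n * 36)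
  2^72n≡4^36n = trans (cong (2 ^_) (double n)) (sym (^-*-assoc 2 2 (n * 36)))
    where
    double : ∀ n → n * 72 ≡ 2 * (n * 36)
    double = solve-∀
  -- With `a = 2 ^ r` and powers of `a` cancelled, this is `(1 + 3 * a) ^ 9 * a ≤ (4 * a) ^ 9`, an
  -- equality at `a = 1`.
  residues : ∀ r → r < 4 → ((2 ^ r) ^ 7 + 3 * (2 ^ r) ^ 8) ^ 9 * 2 ^ r ≤ 4 ^ 9 * (2 ^ r) ^ 72
  residues 0 _ = ≤ᵇ⇒≤ _ _ _
  residues 1 _ = ≤ᵇ⇒≤ _ _ _
  residues 2 _ = ≤ᵇ⇒≤ _ _ _
  residues 3 _ = ≤ᵇ⇒≤ _ _ _
  residues (suc (suc (suc (suc _)))) (s≤s (s≤s (s≤s (s≤s ()))))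

-- Divisors of factorials and indicator functions.

m∣n! : ∀ {m n} → m ≢ 0 → m ≤ n → m ∣ n !
m∣n! {zero}  m≢0 _   = contradiction refl m≢0
m∣n! {suc m} _   m≤n = ∣-trans (m∣m*n (m !)) (m≤n⇒m!∣n! m≤n)

*≢0⇒ : ∀ m n → m * n ≢ 0 → m ≢ 0 × n ≢ 0
*≢0⇒ m n mn≢0 = (λ { refl → mn≢0 refl }) , (λ { refl → mn≢0 (*-zeroʳ m) })

*≤1 : ∀ {m n} → m ≤ 1 → n ≤ 1 → m * n ≤ 1
*≤1 = *-mono-≤

term≤∑ : ∀ {xs : List A} {x} (f : A → ℕ) → x ∈ xs → f x ≤ ∑ xs f
term≤∑ f (here refl)            = m≤m+n _ _
term≤∑ f (there {x = y} x∈xs) = ≤-trans (term≤∑ f x∈xs) (m≤n+m _ (f y))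

sum-concatMap : ∀ (F : A → List ℕ) xs → sum (concatMap F xs) ≡ ∑ xs (sum ∘ F)
sum-concatMap F []       = refl
sum-concatMap F (x ∷ xs) =
  trans (sum-++ (F x) (concatMap F xs)) (cong (sum (F x) +_) (sum-concatMap F xs))

𝟙 : {P : Set} → Dec P → ℕ
𝟙 d = if does d then 1 else 0

𝟙≤1 : {P : Set} (d : Dec P) → 𝟙 d ≤ 1
𝟙≤1 (yes _) = ≤-refl
𝟙≤1 (no _)  = z≤n

𝟙≢0⇒ : {P : Set} (d : Dec P) → 𝟙 d ≢ 0 → P
𝟙≢0⇒ (yes p) _   = p
𝟙≢0⇒ (no _)  0≢0 = contradiction refl 0≢0

⇒𝟙≡1 : {P : Set} (d : Dec P) → P → 𝟙 d ≡ 1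
⇒𝟙≡1 (yes _) _ = refl
⇒𝟙≡1 (no ¬p) p = contradiction p ¬p

-- Enumeration of binary vectors.

∈-allVecs : ∀ {n} (v : Vec Bool n) → v ∈ allVecs n
∈-allVecs []          = here refl
∈-allVecs (false ∷ v) = ∈-concatMap⁺ _ (Any.map (λ { refl → here refl }) (∈-allVecs v))
∈-allVecs (true ∷ v)  = ∈-concatMap⁺ _ (Any.map (λ { refl → there (here refl) }) (∈-allVecs v))

allVecs-unique : ∀ n → Unique (allVecs n)
allVecs-unique zero    = [] ∷ []
allVecs-unique (suc n) = Unique.concat⁺
  (All.map⁺ (All.universal (λ v → ((λ ()) ∷ []) ∷ [] ∷ []) (allVecs n)))
  (AllPairs.map⁺ (AllPairs.map disjoint (allVecs-unique n)))
  where
  disjoint : ∀ {u v : Vec Bool n} → u ≢ v →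
             Disjoint ((false ∷ u) ∷ (true ∷ u) ∷ []) ((false ∷ v) ∷ (true ∷ v) ∷ [])
  disjoint u≢v (here refl , here refl)                 = u≢v refl
  disjoint u≢v (here refl , there (here ()))
  disjoint u≢v (here refl , there (there ()))
  disjoint u≢v (there (here refl) , here ())
  disjoint u≢v (there (here refl) , there (here refl)) = u≢v refl

length-allVecs : ∀ n → length (allVecs n) ≡ 2 ^ n
length-allVecs zero    = refl
length-allVecs (suc n) = trans (length-doubles (allVecs n)) (cong (2 *_) (length-allVecs n))
  where
  length-doubles : ∀ vs → length (concatMap (λ v → (false ∷ v) ∷ (true ∷ v) ∷ []) vs) ≡ 2 * length vs
  length-doubles []       = refl
  length-doubles (v ∷ vs) = trans (cong (2 +_) (length-doubles vs)) (sym (*-suc 2 (length vs)))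

xorᵛ-cancel : ∀ {n} (x z : Vec Bool n) → xorᵛ x (xorᵛ x z) ≡ z
xorᵛ-cancel []       []       = refl
xorᵛ-cancel (x ∷ xs) (z ∷ zs) = cong₂ _∷_
  (trans (sym (xor-assoc x x z)) (cong (_xor z) (xor-same x))) (xorᵛ-cancel xs zs)

xorᵛ-injective : ∀ {n} (x : Vec Bool n) {y z} → xorᵛ x y ≡ xorᵛ x z → y ≡ z
xorᵛ-injective x {y} {z} eq =
  trans (sym (xorᵛ-cancel x y)) (trans (cong (xorᵛ x) eq) (xorᵛ-cancel x z))

-- Arithmetic modulo 4.

all-Bool? : {P : Bool → Set} → (∀ b → Dec (P b)) → Dec (∀ b → P b)
all-Bool? P? with P? false | P? true
... | yes p | yes q = yes λ { false → p ; true → q }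
... | no ¬p | _     = no λ p → ¬p (p false)
... | _     | no ¬q = no λ p → ¬q (p true)

-- The pair (l , h) stands for the residue l + 2h modulo 4.
ℤ₄ : Set
ℤ₄ = Bool × Bool

infixl 6 _+₄_ _⊞_

-- The term `l ∧ l′` is the carry out of the low bit.
_+₄_ : ℤ₄ → ℤ₄ → ℤ₄
(l , h) +₄ (l′ , h′) = l xor l′ , (h xor h′) xor (l ∧ l′)

-₄_ : ℤ₄ → ℤ₄
-₄ (l , h) = l , l xor h

_≟₄_ : (u v : ℤ₄) → Dec (u ≡ v)
_≟₄_ = Product.≡-dec Bool._≟_ Bool._≟_

+₄-assoc : ∀ u v w → (u +₄ v) +₄ w ≡ u +₄ (v +₄ w)
+₄-assoc (a , b) (c , d) (e , f) = from-yes
  (all-Bool? λ a → all-Bool? λ b → all-Bool? λ c → all-Bool? λ d → all-Bool? λ e → all-Bool? λ f →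
    ((a , b) +₄ (c , d) +₄ (e , f)) ≟₄ ((a , b) +₄ ((c , d) +₄ (e , f)))) a b c d e f

+₄-comm : ∀ u v → u +₄ v ≡ v +₄ u
+₄-comm (a , b) (c , d) = from-yes
  (all-Bool? λ a → all-Bool? λ b → all-Bool? λ c → all-Bool? λ d →
    ((a , b) +₄ (c , d)) ≟₄ ((c , d) +₄ (a , b))) a b c d

+₄-identityˡ : ∀ u → (false , false) +₄ u ≡ u
+₄-identityˡ (a , b) = from-yes
  (all-Bool? λ a → all-Bool? λ b → ((false , false) +₄ (a , b)) ≟₄ (a , b)) a b

+₄-inverseˡ : ∀ u → (-₄ u) +₄ u ≡ (false , false)
+₄-inverseˡ (a , b) = from-yes
  (all-Bool? λ a → all-Bool? λ b → ((-₄ (a , b)) +₄ (a , b)) ≟₄ (false , false)) a b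

_⊞_ : ∀ {n} → Vec ℤ₄ n → Vec ℤ₄ n → Vec ℤ₄ n
_⊞_ = zipWith _+₄_

ℤ₄ⁿ : ℕ → AbelianGroup _ _
ℤ₄ⁿ n = record
  { Carrier = Vec ℤ₄ n
  ; _≈_ = _≡_
  ; _∙_ = _⊞_
  ; ε   = Vec.replicate n (false , false)
  ; _⁻¹ = Vec.map -₄_
  ; isAbelianGroup = record
    { isGroup = record
      { isMonoid = record
        { isSemigroup = record
          { isMagma = isMagma _⊞_
          ; assoc = Vec.zipWith-assoc +₄-assoc }
        ; identity = comm∧idˡ⇒id comm (Vec.zipWith-identityˡ +₄-identityˡ) }
      ; inverse = comm∧invˡ⇒inv comm (Vec.zipWith-inverseˡ +₄-inverseˡ)
      ; ⁻¹-cong = cong (Vec.map -₄_) }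
    ; comm = comm } }
  where
  comm : ∀ (u v : Vec ℤ₄ n) → u ⊞ v ≡ v ⊞ u
  comm = Vec.zipWith-comm +₄-comm
  open Consequences (setoid (Vec ℤ₄ n))

low : ∀ {n} → Vec ℤ₄ n → Vec Bool n
low = Vec.map proj₁

-- A double is even, so adding it leaves residues modulo 2 alone.
low-⊞-double : ∀ {n} (u v : Vec ℤ₄ n) → low (u ⊞ (v ⊞ v)) ≡ low u
low-⊞-double []            []            = refl
low-⊞-double ((l , _) ∷ u) ((m , _) ∷ v) = cong₂ _∷_
  (trans (cong (l xor_) (xor-same m)) (xor-identityʳ l)) (low-⊞-double u v)

-- Twice `l + 2h` is `2l` modulo 4, so a double still shows the low bits.
high-double : ∀ {n} (u : Vec ℤ₄ n) → Vec.map proj₂ (u ⊞ u) ≡ low u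
high-double []            = refl
high-double ((l , h) ∷ u) = cong₂ _∷_
  (cong₂ _xor_ (xor-same h) (∧-idem l)) (high-double u)

winCoord⇒ : ∀ x y a b c → T (winCoord x y (x xor y) a b c) →
            (x , a) +₄ (y , b) ≡ -₄ (x xor y , c)
winCoord⇒ = from-yes
  (all-Bool? λ x → all-Bool? λ y → all-Bool? λ a → all-Bool? λ b → all-Bool? λ c →
    T? (winCoord x y (x xor y) a b c) →-dec (((x , a) +₄ (y , b)) ≟₄ (-₄ (x xor y , c))))

-- Since x ∨ y ∨ z = (x + y + z) / 2 in ℤ, a win says (x + 2a) + (y + 2b) + (z + 2c) = 0 mod 4.
winAll⇒ : ∀ {n} (x y a b c : Vec Bool n) → T (winAll x y (xorᵛ x y) a b c) →
          zip x a ⊞ zip y b ≡ Vec.map -₄_ (zip (xorᵛ x y) c)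
winAll⇒ []       []       []       []       []       _   = refl
winAll⇒ (x ∷ xs) (y ∷ ys) (a ∷ as) (b ∷ bs) (c ∷ cs) win
  with win₀ , wins ← Equivalence.to T-∧ win
  = cong₂ _∷_ (winCoord⇒ x y a b c win₀) (winAll⇒ xs ys as bs cs wins)

-- Cancellation in (ℤ/4)ⁿ and lifted strategies.

module _ (n : ℕ) where
  open AbelianGroup (ℤ₄ⁿ n) using (group; commutativeMonoid)
  open import Algebra.Properties.Group group using (∙-cancelˡ; ∙-cancelʳ)
  open import Algebra.Solver.CommutativeMonoid commutativeMonoid
    renaming (solve to solveᵐ; _⊜_ to _⊜ᵐ_; _⊕_ to _⊕ᵐ_)

  -- The relation `X - Y = A - B` of two pairs meets the winning condition `B = κ - C`. Substituting
  -- yields `X - Y = A + C - κ`, whose right side is symmetric in `A` and `C`.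
  through-constant : ∀ {X A B Y C κ : Vec ℤ₄ n} → X ⊞ B ≡ A ⊞ Y → C ⊞ B ≡ κ →
                     X ⊞ κ ≡ A ⊞ C ⊞ Y
  through-constant {X} {A} {B} {Y} {C} {κ} XB≡AY CB≡κ = begin
    X ⊞ κ        ≡⟨ cong (X ⊞_) CB≡κ ⟨
    X ⊞ (C ⊞ B)  ≡⟨ solveᵐ 3 (λ X C B → X ⊕ᵐ (C ⊕ᵐ B) ⊜ᵐ (X ⊕ᵐ B) ⊕ᵐ C) refl X C B ⟩
    X ⊞ B ⊞ C    ≡⟨ cong (_⊞ C) XB≡AY ⟩
    A ⊞ Y ⊞ C    ≡⟨ solveᵐ 3 (λ A Y C → (A ⊕ᵐ Y) ⊕ᵐ C ⊜ᵐ (A ⊕ᵐ C) ⊕ᵐ Y) refl A Y C ⟩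
    A ⊞ C ⊞ Y    ∎
    where open ≡-Reasoning

  -- The first equation minus the second plus the third: `A₁` and `A₃` cancel, and `A₂` survives
  -- doubled.
  eliminate : ∀ {X P R A₁ A₂ A₃ Y Q S κ : Vec ℤ₄ n} →
              X ⊞ κ ≡ A₁ ⊞ A₂ ⊞ Y → P ⊞ κ ≡ A₁ ⊞ A₃ ⊞ Q → R ⊞ κ ≡ A₂ ⊞ A₃ ⊞ S →
              X ⊞ (κ ⊞ R ⊞ Q) ≡ (A₂ ⊞ A₂) ⊞ (P ⊞ Y ⊞ S)
  eliminate {X} {P} {R} {A₁} {A₂} {A₃} {Y} {Q} {S} {κ} eX eP eR = ∙-cancelʳ κ _ _ (begin
    X ⊞ (κ ⊞ R ⊞ Q) ⊞ κ
      ≡⟨ solveᵐ 4 (λ X κ R Q → (X ⊕ᵐ ((κ ⊕ᵐ R) ⊕ᵐ Q)) ⊕ᵐ κ ⊜ᵐ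
           ((X ⊕ᵐ κ) ⊕ᵐ (R ⊕ᵐ κ)) ⊕ᵐ Q) refl X κ R Q ⟩
    X ⊞ κ ⊞ (R ⊞ κ) ⊞ Q
      ≡⟨ cong₂ (λ U V → U ⊞ V ⊞ Q) eX eR ⟩
    A₁ ⊞ A₂ ⊞ Y ⊞ (A₂ ⊞ A₃ ⊞ S) ⊞ Q
      ≡⟨ solveᵐ 6 (λ A₁ A₂ A₃ Y S Q → (((A₁ ⊕ᵐ A₂) ⊕ᵐ Y) ⊕ᵐ ((A₂ ⊕ᵐ A₃) ⊕ᵐ S)) ⊕ᵐ Q ⊜ᵐ
           (A₂ ⊕ᵐ A₂) ⊕ᵐ ((((A₁ ⊕ᵐ A₃) ⊕ᵐ Q) ⊕ᵐ Y) ⊕ᵐ S)) refl A₁ A₂ A₃ Y S Q ⟩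
    A₂ ⊞ A₂ ⊞ (A₁ ⊞ A₃ ⊞ Q ⊞ Y ⊞ S)
      ≡⟨ cong (λ U → A₂ ⊞ A₂ ⊞ (U ⊞ Y ⊞ S)) eP ⟨
    A₂ ⊞ A₂ ⊞ (P ⊞ κ ⊞ Y ⊞ S)
      ≡⟨ solveᵐ 5 (λ A P κ Y S → A ⊕ᵐ (((P ⊕ᵐ κ) ⊕ᵐ Y) ⊕ᵐ S) ⊜ᵐ (A ⊕ᵐ ((P ⊕ᵐ Y) ⊕ᵐ S)) ⊕ᵐ κ)
           refl (A₂ ⊞ A₂) P κ Y S ⟩
    A₂ ⊞ A₂ ⊞ (P ⊞ Y ⊞ S) ⊞ κ ∎)
    where open ≡-Reasoning

  -- Both `X - D` and `X′ - D′` equal `M′ - M`; the conclusion is in the subtraction-free form that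
  -- `lift+double-injective` takes.
  cross : ∀ {X X′ D D′ M M′ : Vec ℤ₄ n} → X ⊞ M ≡ D ⊞ M′ → X′ ⊞ M ≡ D′ ⊞ M′ → X ⊞ D′ ≡ X′ ⊞ D
  cross {X} {X′} {D} {D′} {M} {M′} e e′ = ∙-cancelʳ (M ⊞ M′) _ _ (begin
    X ⊞ D′ ⊞ (M ⊞ M′)
      ≡⟨ solveᵐ 4 (λ X D M N → (X ⊕ᵐ D) ⊕ᵐ (M ⊕ᵐ N) ⊜ᵐ (X ⊕ᵐ M) ⊕ᵐ (D ⊕ᵐ N)) refl X D′ M M′ ⟩
    X ⊞ M ⊞ (D′ ⊞ M′)
      ≡⟨ cong₂ _⊞_ e (sym e′) ⟩
    D ⊞ M′ ⊞ (X′ ⊞ M)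
      ≡⟨ solveᵐ 4 (λ D N X M → (D ⊕ᵐ N) ⊕ᵐ (X ⊕ᵐ M) ⊜ᵐ (X ⊕ᵐ D) ⊕ᵐ (M ⊕ᵐ N)) refl D M′ X′ M ⟩
    X′ ⊞ D ⊞ (M ⊞ M′) ∎)
    where open ≡-Reasoning

  module _ (f : Strategy n) where

    lift : Vec Bool n → Vec ℤ₄ n
    lift x = zip x (f x)

    low-lift : ∀ x → low (lift x) ≡ x
    low-lift x = Vec.map-proj₁-zip x (f x)

    lift-injective : ∀ {x y} → lift x ≡ lift y → x ≡ y
    lift-injective {x} {y} eq = trans (sym (low-lift x)) (trans (cong low eq) (low-lift y))

    lift-double-injective : ∀ {x y} → lift x ⊞ lift x ≡ lift y ⊞ lift y → x ≡ y
    lift-double-injective {x} {y} eq = begin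
      x                                   ≡⟨ low-lift x ⟨
      low (lift x)                        ≡⟨ high-double (lift x) ⟨
      Vec.map proj₂ (lift x ⊞ lift x)     ≡⟨ cong (Vec.map proj₂) eq ⟩
      Vec.map proj₂ (lift y ⊞ lift y)     ≡⟨ high-double (lift y) ⟩
      low (lift y)                        ≡⟨ low-lift y ⟩
      y                                   ∎
      where open ≡-Reasoning

    -- Reducing mod 2 kills the doubles and reveals x; the doubles then reveal y.
    lift+double-injective : ∀ {x x′ y y′} →
      lift x ⊞ (lift y′ ⊞ lift y′) ≡ lift x′ ⊞ (lift y ⊞ lift y) → x ≡ x′ × y ≡ y′
    lift+double-injective {x} {x′} {y} {y′} eq = x≡x′ ,
      lift-double-injective (sym (∙-cancelˡ (lift x) _ _
        (trans eq (cong (λ u → lift u ⊞ (lift y ⊞ lift y)) (sym x≡x′)))))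
      where
      open ≡-Reasoning
      x≡x′ : x ≡ x′
      x≡x′ = begin
        x                                     ≡⟨ low-lift x ⟨
        low (lift x)                          ≡⟨ low-⊞-double (lift x) (lift y′) ⟨
        low (lift x ⊞ (lift y′ ⊞ lift y′))    ≡⟨ cong low eq ⟩
        low (lift x′ ⊞ (lift y ⊞ lift y))     ≡⟨ low-⊞-double (lift x′) (lift y) ⟩
        low (lift x′)                         ≡⟨ low-lift x′ ⟩
        x′                                    ∎

-- Won questions and classes of related pairs.

module Repetition {n : ℕ} (f g h : Strategy n) where
  open AbelianGroup (ℤ₄ⁿ n) using (group)
  open import Algebra.Properties.Group group using (∙-cancelˡ; ∙-cancelʳ)

  V V² V³ : Set
  V  = Vec Bool n
  V² = V × V
  V³ = V × V²

  L : List V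
  L = allVecs n

  L² : List V²
  L² = cartesianProduct L L

  L³ : List V³
  L³ = cartesianProduct L L²

  N : ℕ
  N = length L

  L²-unique : Unique L²
  L²-unique = Unique.cartesianProduct⁺ (allVecs-unique n) (allVecs-unique n)

  L³-unique : Unique L³
  L³-unique = Unique.cartesianProduct⁺ (allVecs-unique n) L²-unique

  ∈L² : ∀ p → p ∈ L²
  ∈L² (x , y) = ∈-cartesianProduct⁺ (∈-allVecs x) (∈-allVecs y)

  ∈L³ : ∀ p → p ∈ L³
  ∈L³ (x , p) = ∈-cartesianProduct⁺ (∈-allVecs x) (∈L² p)

  F G H : V → Vec ℤ₄ n
  F = lift n f
  G = lift n g
  H = lift n h

  wins? : ∀ x y → Dec (T (winAll x y (xorᵛ x y) (f x) (g y) (h (xorᵛ x y))))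
  wins? x y = T? _

  -- The indicator of the set A belonging to z.
  member : V → V → ℕ
  member z x = 𝟙 (wins? x (xorᵛ x z))

  member≤1 : ∀ z x → member z x ≤ 1
  member≤1 z x = 𝟙≤1 (wins? x (xorᵛ x z))

  member⇒ : ∀ z x → member z x ≢ 0 → F x ⊞ G (xorᵛ x z) ≡ Vec.map -₄_ (H z)
  member⇒ z x mem = trans
    (winAll⇒ x (xorᵛ x z) (f x) (g (xorᵛ x z)) _ (𝟙≢0⇒ (wins? x (xorᵛ x z)) mem))
    (cong (λ t → Vec.map -₄_ (H t)) (xorᵛ-cancel x z))

  -- The change of variables from `(x , y)` to `(xorᵛ x y , x)` groups the won questions by
  -- Charlie's question.
  winCount≤ : winCount n f g h ≤ ∑ L (λ z → ∑ L (member z))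
  winCount≤ = begin
    winCount n f g h
      ≡⟨ sum-concatMap (λ x → map (λ y → 𝟙 (wins? x y)) L) L ⟩
    ∑ L (λ x → ∑ L (λ y → 𝟙 (wins? x y)))
      ≡⟨ ∑-cartesianProduct L L _ ⟨
    ∑ L² (λ (x , y) → 𝟙 (wins? x y))
      ≤⟨ ∑-injection (λ (x , y) → xorᵛ x y , x) L²-unique
           (λ (x , y) _ → ∈L² _ , ≤-reflexive (cong (λ t → 𝟙 (wins? x t)) (sym (xorᵛ-cancel x y))))
           (λ (x , y) (x′ , y′) _ _ eq → inj x y x′ y′ (,-injective eq)) ⟩
    ∑ L² (λ (z , x) → member z x)
      ≡⟨ ∑-cartesianProduct L L _ ⟩
    ∑ L (λ z → ∑ L (member z)) ∎
    where
    open ≤-Reasoning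
    inj : ∀ (x y x′ y′ : V) → xorᵛ x y ≡ xorᵛ x′ y′ × x ≡ x′ → (x , y) ≡ (x′ , y′)
    inj x y _ y′ (eq , refl) = cong (x ,_) (xorᵛ-injective x eq)

  -- F − G agrees on the two pairs; written without subtraction.
  related? : (p q : V²) → Dec (F (proj₁ p) ⊞ G (proj₂ q) ≡ F (proj₁ q) ⊞ G (proj₂ p))
  related? p q = Vec.≡-dec _≟₄_ _ _

  related : V² → V² → ℕ
  related q p = 𝟙 (related? p q)

  -- The size of the fibre of `F p - G q` through a given pair; at `pair z x x′` it is the number
  -- `k(x , x′)`.
  classSize : V² → ℕ
  classSize q = ∑ L² (related q)

  classSize≢0 : ∀ q → classSize q ≢ 0
  classSize≢0 q eq with () ← subst₂ _≤_ (⇒𝟙≡1 (related? q q) refl) eq (term≤∑ (related q) (∈L² q))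

  classSize≤ : ∀ q → classSize q ≤ length L²
  classSize≤ q = ≤-trans (∑-mono L² (λ p → 𝟙≤1 (related? p q)))
    (≤-reflexive (trans (∑-const L² 1) (*-identityʳ _)))

  -- A common denominator: class sizes lie between 1 and `length L²`, so all of them divide this
  -- factorial and their reciprocals become natural numbers.
  D : ℕ
  D = length L² !

  classSize∣D : ∀ q → classSize q ∣ D
  classSize∣D q = m∣n! (classSize≢0 q) (classSize≤ q)

  -- D / classSize q
  weight : V² → ℕ
  weight q = quotient (classSize∣D q)

  classSize*weight : ∀ q → classSize q * weight q ≡ D
  classSize*weight q = trans (*-comm (classSize q) (weight q)) (sym (_∣_.equality (classSize∣D q)))

  pair : V → V → V → V²
  pair z x x′ = x , xorᵛ x′ z

  weightedPairs : V → ℕ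
  weightedPairs z = ∑ L² (λ (x₁ , x₂) → member z x₁ * member z x₂ * weight (pair z x₁ x₂))

  -- For members `x₁`, `x₂` of one `z`, both `F xᵢ + G (xᵢ ⊕ z)` equal `- H z`, so `pair z x₁ x₂`
  -- and `pair z x₂ x₁` are related; together they determine `z`, `x₁`, `x₂`. In the sum over all
  -- related pairs, each of the `N * N` choices of `q` contributes `classSize q` copies of
  -- `weight q`, which is `D`.
  ∑-weightedPairs≤ : ∑ L weightedPairs ≤ N * N * D
  ∑-weightedPairs≤ = begin
    ∑ L weightedPairs
      ≡⟨ ∑-cartesianProduct L L² _ ⟨
    ∑ L³ (λ (z , x₁ , x₂) → member z x₁ * member z x₂ * weight (pair z x₁ x₂))
      ≤⟨ ∑-injection (λ (z , x₁ , x₂) → pair z x₁ x₂ , pair z x₂ x₁) L³-unique into inj ⟩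
    ∑ (cartesianProduct L² L²) (λ (q , p) → related q p * weight q)
      ≡⟨ ∑-cartesianProduct L² L² _ ⟩
    ∑ L² (λ q → ∑ L² (λ p → related q p * weight q))
      ≡⟨ ∑-cong L² (λ q → trans (sym (*-distribʳ-∑ (weight q) L² (related q))) (classSize*weight q)) ⟩
    ∑ L² (λ _ → D)
      ≡⟨ trans (∑-const L² D) (cong (_* D) (length-cartesianProduct L L)) ⟩
    N * N * D ∎
    where
    open ≤-Reasoning
    into : ∀ (t : V³) → let (z , x₁ , x₂) = t in
           member z x₁ * member z x₂ * weight (pair z x₁ x₂) ≢ 0 →
           (pair z x₁ x₂ , pair z x₂ x₁) ∈ cartesianProduct L² L² ×
           member z x₁ * member z x₂ * weight (pair z x₁ x₂)
             ≤ related (pair z x₁ x₂) (pair z x₂ x₁) * weight (pair z x₁ x₂)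
    into (z , x₁ , x₂) ≢0
      with m₁m₂≢0 , _ ← *≢0⇒ _ _ ≢0
      with m₁≢0 , m₂≢0 ← *≢0⇒ (member z x₁) (member z x₂) m₁m₂≢0
      = ∈-cartesianProduct⁺ (∈L² _) (∈L² _) ,
        *-monoˡ-≤ (weight (pair z x₁ x₂))
          (≤-trans (*≤1 (member≤1 z x₁) (member≤1 z x₂))
            (≤-reflexive (sym (⇒𝟙≡1 (related? (pair z x₂ x₁) (pair z x₁ x₂))
              (trans (member⇒ z x₂ m₂≢0) (sym (member⇒ z x₁ m₁≢0)))))))
    inj : ∀ (t t′ : V³) → let (z , x₁ , x₂) = t; (z′ , x₁′ , x₂′) = t′ in _ → _ →
          (pair z x₁ x₂ , pair z x₂ x₁) ≡ (pair z′ x₁′ x₂′ , pair z′ x₂′ x₁′) → t ≡ t′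
    inj (z , x₁ , x₂) (z′ , x₁′ , x₂′) _ _ eq
      with e , e′ ← ,-injective eq
      with refl , e″ ← ,-injective e
      with refl , _ ← ,-injective e′
      with refl ← xorᵛ-injective x₂ e″
      = refl

  -- Sums over triples of members.

  members : V → V³ → ℕ
  members z (x₁ , x₂ , x₃) = member z x₁ * (member z x₂ * member z x₃)

  classSizes : V → V³ → ℕ
  classSizes z (x₁ , x₂ , x₃) =
    classSize (pair z x₁ x₂) * (classSize (pair z x₁ x₃) * classSize (pair z x₂ x₃))

  -- F xᵢ + F xⱼ + H z = F p − G q for every pair (p , q) related to (xᵢ , xⱼ ⊕ z), so
  -- (x₁ , x₂ , x₃) with a pair (x , y) related to (x₁ , x₂ ⊕ z) and pairs p, r for the other
  -- two indices can be recovered from y, p, r: these determine F x − 2 F x₂.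
  ∑-classSizes≤ : ∀ z → ∑ L³ (λ t → members z t * classSizes z t) ≤ N ^ 5
  ∑-classSizes≤ z = begin
    ∑ L³ (λ t → members z t * classSizes z t)
      ≡⟨ ∑-cong L³ expand ⟩
    ∑ L³ (λ t → ∑ L⁶ (λ s → summand (t , s)))
      ≡⟨ ∑-cartesianProduct L³ L⁶ summand ⟨
    ∑ (cartesianProduct L³ L⁶) summand
      ≤⟨ ∑-injection φ (Unique.cartesianProduct⁺ L³-unique
           (Unique.cartesianProduct⁺ L²-unique (Unique.cartesianProduct⁺ L²-unique L²-unique))) into inj ⟩
    ∑ L⁵ (λ _ → 1)
      ≡⟨ trans (∑-const L⁵ 1) (*-identityʳ (length L⁵)) ⟩
    length L⁵
      ≡⟨ length-L⁵ ⟩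
    N ^ 5 ∎
    where
    open ≤-Reasoning
    L⁶ = cartesianProduct L² (cartesianProduct L² L²)
    L⁵ = cartesianProduct L (cartesianProduct L² L²)
    fifth : ∀ N → N * (N * N * (N * N)) ≡ N ^ 5
    fifth = solve 1 (λ N → N :* (N :* N :* (N :* N)) := N :^ 5) refl
    length-L⁵ : length L⁵ ≡ N ^ 5
    length-L⁵ = trans (length-cartesianProduct L (cartesianProduct L² L²)) (trans (cong (N *_)
      (trans (length-cartesianProduct L² L²)
        (cong₂ _*_ (length-cartesianProduct L L) (length-cartesianProduct L L))))
      (fifth N))
    summand : V³ × (V² × (V² × V²)) → ℕ
    summand (t@(x₁ , x₂ , x₃) , q , p , r) = members z t *
      (related (pair z x₁ x₂) q * (related (pair z x₁ x₃) p * related (pair z x₂ x₃) r))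
    expand : ∀ t → members z t * classSizes z t ≡ ∑ L⁶ (λ s → summand (t , s))
    expand t@(x₁ , x₂ , x₃) = trans
      (cong (members z t *_) (trans
        (cong (classSize (pair z x₁ x₂) *_) (∑-*-∑ L² L² _ _))
        (∑-*-∑ L² (cartesianProduct L² L²) _ _)))
      (*-distribˡ-∑ (members z t) L⁶ _)
    -- Five of the nine vectors are kept, whence the exponent in `N ^ 5`.
    φ : V³ × (V² × (V² × V²)) → V × (V² × V²)
    φ (_ , (_ , y) , p , r) = y , p , r
    into : ∀ s → summand s ≢ 0 → φ s ∈ L⁵ × summand s ≤ 1
    into ((x₁ , x₂ , x₃) , q , p , r) _ =
      ∈-cartesianProduct⁺ (∈-allVecs _) (∈-cartesianProduct⁺ (∈L² _) (∈L² _)) ,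
      *≤1 (*≤1 (member≤1 z x₁) (*≤1 (member≤1 z x₂) (member≤1 z x₃)))
        (*≤1 (𝟙≤1 (related? q _)) (*≤1 (𝟙≤1 (related? p _)) (𝟙≤1 (related? r _))))
    κ = Vec.map -₄_ (H z)
    Equations : V³ × (V² × (V² × V²)) → Set
    Equations ((x₁ , x₂ , x₃) , (x , y) , (p , q) , (r , s)) =
      F x ⊞ κ ≡ F x₁ ⊞ F x₂ ⊞ G y ×
      F p ⊞ κ ≡ F x₁ ⊞ F x₃ ⊞ G q ×
      F r ⊞ κ ≡ F x₂ ⊞ F x₃ ⊞ G s
    equations : ∀ s → summand s ≢ 0 → Equations s
    equations ((x₁ , x₂ , x₃) , q , p , r) ≢0 =
      let m≢0 , e≢0    = *≢0⇒ (members z (x₁ , x₂ , x₃)) _ ≢0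
          _ , m₂₃≢0    = *≢0⇒ (member z x₁) _ m≢0
          m₂≢0 , m₃≢0  = *≢0⇒ (member z x₂) _ m₂₃≢0
          q≢0 , pr≢0   = *≢0⇒ (related (pair z x₁ x₂) q) _ e≢0
          p≢0 , r≢0    = *≢0⇒ (related (pair z x₁ x₃) p) _ pr≢0
      in  through-constant n (𝟙≢0⇒ (related? q _) q≢0) (member⇒ z x₂ m₂≢0) ,
          through-constant n (𝟙≢0⇒ (related? p _) p≢0) (member⇒ z x₃ m₃≢0) ,
          through-constant n (𝟙≢0⇒ (related? r _) r≢0) (member⇒ z x₃ m₃≢0)
    recover : ∀ {x₁ x₂ x₃ x₁′ x₂′ x₃′ x x′} y p r →
              Equations ((x₁ , x₂ , x₃) , (x , y) , p , r) →
              Equations ((x₁′ , x₂′ , x₃′) , (x′ , y) , p , r) →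
              x₁ ≡ x₁′ × x₂ ≡ x₂′ × x₃ ≡ x₃′ × x ≡ x′
    recover {x₁} {x₂} {x₃} {x₁′} {x₂′} {x₃′} {x} {x′} y (p , q) (r , s) (eX , eP , eR) (eX′ , eP′ , eR′) =
      x₁≡x₁′ , x₂≡x₂′ , x₃≡x₃′ , x≡x′
      where
      -- After elimination the terms besides `F x` and `F x₂ ⊞ F x₂` depend on `z`, `y`, `p`, `q`,
      -- `r`, `s` alone, hence agree for both solutions.
      x≡x′∧x₂≡x₂′ : x ≡ x′ × x₂ ≡ x₂′
      x≡x′∧x₂≡x₂′ = lift+double-injective n f
        (cross n (eliminate n eX eP eR) (eliminate n eX′ eP′ eR′))
      x≡x′ = proj₁ x≡x′∧x₂≡x₂′
      x₂≡x₂′ = proj₂ x≡x′∧x₂≡x₂′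
      -- With `x` and `x₂` known, the first equation isolates `F x₁`; the second then isolates
      -- `F x₃`.
      x₁≡x₁′ : x₁ ≡ x₁′
      x₁≡x₁′ = lift-injective n f (∙-cancelʳ (F x₂) _ _ (∙-cancelʳ (G y) _ _
        (trans (sym eX) (subst₂ (λ u v → F u ⊞ κ ≡ F x₁′ ⊞ F v ⊞ G y) (sym x≡x′) (sym x₂≡x₂′) eX′))))
      x₃≡x₃′ : x₃ ≡ x₃′
      x₃≡x₃′ = lift-injective n f (∙-cancelˡ (F x₁) _ _ (∙-cancelʳ (G q) _ _
        (trans (sym eP) (subst (λ u → F p ⊞ κ ≡ F u ⊞ F x₃′ ⊞ G q) (sym x₁≡x₁′) eP′))))
    inj : ∀ s s′ → summand s ≢ 0 → summand s′ ≢ 0 → φ s ≡ φ s′ → s ≡ s′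
    inj s@(_ , (_ , y) , p , r) s′ ≢0 ≢0′ refl =
      let e₁ , e₂ , e₃ , e = recover y p r (equations s ≢0) (equations s′ ≢0′)
      in  cong₂ _,_ (cong₂ _,_ e₁ (cong₂ _,_ e₂ e₃)) (cong (λ u → (u , y) , p , r) e)

  -- For summands bounded in terms of two of the three points: `φ` moves the free point to the
  -- front, where summing over it costs a factor `N`.
  ∑-project≤ : ∀ {e : V³ → ℕ} {e′ : V² → ℕ} (φ : V³ → V × V²) →
               (∀ t t′ → φ t ≡ φ t′ → t ≡ t′) → (∀ t → e t ≤ e′ (proj₂ (φ t))) →
               ∑ L³ e ≤ N * ∑ L² e′
  ∑-project≤ {e} {e′} φ φ-inj e≤e′ = begin
    ∑ L³ e                  ≤⟨ ∑-injection φ L³-unique (λ t _ → ∈L³ _ , e≤e′ t) (λ t t′ _ _ → φ-inj t t′) ⟩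
    ∑ L³ (e′ ∘ proj₂)       ≡⟨ ∑-cartesianProduct L L² _ ⟩
    ∑ L (λ _ → ∑ L² e′)     ≡⟨ ∑-const L _ ⟩
    N * ∑ L² e′             ∎
    where open ≤-Reasoning

  weights : V → V³ → ℕ
  weights z (x₁ , x₂ , x₃) = weight (pair z x₁ x₂) + (weight (pair z x₁ x₃) + weight (pair z x₂ x₃))

  ∑-weights≤ : ∀ z → ∑ L³ (λ t → members z t * weights z t) ≤ 3 * (N * weightedPairs z)
  ∑-weights≤ z = begin
    ∑ L³ (λ t → members z t * weights z t)
      ≡⟨ ∑-cong L³ distrib ⟩
    ∑ L³ (λ t → w₁₂ t + (w₁₃ t + w₂₃ t))
      ≡⟨ trans (∑-distrib-+ L³ w₁₂ _) (cong (∑ L³ w₁₂ +_) (∑-distrib-+ L³ w₁₃ w₂₃)) ⟩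
    ∑ L³ w₁₂ + (∑ L³ w₁₃ + ∑ L³ w₂₃)
      ≤⟨ +-mono-≤
           (∑-project≤ (λ (x₁ , x₂ , x₃) → x₃ , x₁ , x₂) (λ { _ _ refl → refl })
             (λ (x₁ , x₂ , x₃) → *-monoˡ-≤ (weight (pair z x₁ x₂))
               (drop₃ (member z x₁) (member z x₂) (member≤1 z x₃))))
           (+-mono-≤
             (∑-project≤ (λ (x₁ , x₂ , x₃) → x₂ , x₁ , x₃) (λ { _ _ refl → refl })
               (λ (x₁ , x₂ , x₃) → *-monoˡ-≤ (weight (pair z x₁ x₃))
                 (drop₂ (member z x₁) (member z x₃) (member≤1 z x₂))))
             (∑-project≤ (λ t → t) (λ { _ _ refl → refl })
               (λ (x₁ , x₂ , x₃) → *-monoˡ-≤ (weight (pair z x₂ x₃))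
                 (drop₁ (member z x₂ * member z x₃) (member≤1 z x₁))))) ⟩
    N * weightedPairs z + (N * weightedPairs z + N * weightedPairs z)
      ≡⟨ triple (N * weightedPairs z) ⟩
    3 * (N * weightedPairs z) ∎
    where
    open ≤-Reasoning
    w₁₂ w₁₃ w₂₃ : V³ → ℕ
    w₁₂ t@(x₁ , x₂ , x₃) = members z t * weight (pair z x₁ x₂)
    w₁₃ t@(x₁ , x₂ , x₃) = members z t * weight (pair z x₁ x₃)
    w₂₃ t@(x₁ , x₂ , x₃) = members z t * weight (pair z x₂ x₃)
    distrib′ : ∀ m a b c → m * (a + (b + c)) ≡ m * a + (m * b + m * c)
    distrib′ = solve-∀
    distrib : ∀ t → members z t * weights z t ≡ w₁₂ t + (w₁₃ t + w₂₃ t)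
    distrib t = distrib′ (members z t) _ _ _
    triple : ∀ s → s + (s + s) ≡ 3 * s
    triple = solve-∀
    drop₁ : ∀ {m} a → m ≤ 1 → m * a ≤ a
    drop₁ a m≤1 = ≤-trans (*-monoˡ-≤ a m≤1) (≤-reflexive (*-identityˡ a))
    drop₂ : ∀ {m} a b → m ≤ 1 → a * (m * b) ≤ a * b
    drop₂ a b m≤1 = *-monoʳ-≤ a (drop₁ b m≤1)
    drop₃ : ∀ {m} a b → m ≤ 1 → a * (b * m) ≤ a * b
    drop₃ {m} a b m≤1 = subst (λ t → a * t ≤ a * b) (*-comm m b) (drop₂ a b m≤1)

  -- Combining the estimates.

  -- This is `|A|³` for the set `A` of `z`, kept as a sum over triples so that AM-GM applies term by
  -- term.
  memberTriples : V → ℕ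
  memberTriples z = ∑ L³ (members z)

  -- AM-GM at every triple of members. The products of class sizes are bounded for each `z`
  -- separately, giving `N * N ^ 5`, whereas the reciprocals are controlled only after summing over
  -- `z`.
  memberTriples-bound : ∀ c → 4 * (c ^ 3 * D) * ∑ L memberTriples ≤ (N ^ 6 + 3 * c ^ 4 * N ^ 3) * D
  memberTriples-bound c = begin
    K * ∑ L memberTriples
      ≡⟨ *-distribˡ-∑ K L memberTriples ⟩
    ∑ L (λ z → K * memberTriples z)
      ≤⟨ ∑-mono L per-z ⟩
    ∑ L (λ z → N ^ 5 * D + c ^ 4 * (3 * (N * weightedPairs z)))
      ≡⟨ ∑-distrib-+ L _ _ ⟩
    ∑ L (λ _ → N ^ 5 * D) + ∑ L (λ z → c ^ 4 * (3 * (N * weightedPairs z)))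
      ≡⟨ cong₂ _+_ (∑-const L (N ^ 5 * D)) (∑-cong L (λ z → regroup (c ^ 4) N (weightedPairs z))) ⟩
    N * (N ^ 5 * D) + ∑ L (λ z → 3 * c ^ 4 * N * weightedPairs z)
      ≡⟨ cong (N * (N ^ 5 * D) +_) (*-distribˡ-∑ (3 * c ^ 4 * N) L weightedPairs) ⟨
    N * (N ^ 5 * D) + 3 * c ^ 4 * N * ∑ L weightedPairs
      ≤⟨ +-monoʳ-≤ (N * (N ^ 5 * D)) (*-monoʳ-≤ (3 * c ^ 4 * N) ∑-weightedPairs≤) ⟩
    N * (N ^ 5 * D) + 3 * c ^ 4 * N * (N * N * D)
      ≡⟨ collect N (c ^ 4) D ⟩
    (N ^ 6 + 3 * c ^ 4 * N ^ 3) * D ∎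
    where
    open ≤-Reasoning
    K = 4 * (c ^ 3 * D)
    regroup : ∀ k N s → k * (3 * (N * s)) ≡ 3 * k * N * s
    regroup = solve-∀
    collect : ∀ N k D → N * (N ^ 5 * D) + 3 * k * N * (N * N * D) ≡ (N ^ 6 + 3 * k * N ^ 3) * D
    collect = solve 3 (λ N k D → N :* (N :^ 5 :* D) :+ con 3 :* k :* N :* (N :* N :* D)
                        := (N :^ 6 :+ con 3 :* k :* N :^ 3) :* D) refl
    distrib : ∀ m s D k r → m * (s * D + k * r) ≡ m * s * D + k * (m * r)
    distrib = solve-∀
    per-z : ∀ z → K * memberTriples z ≤ N ^ 5 * D + c ^ 4 * (3 * (N * weightedPairs z))
    per-z z = begin
      K * memberTriples z
        ≡⟨ trans (*-distribˡ-∑ K L³ (members z)) (∑-cong L³ (λ t → *-comm K (members z t))) ⟩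
      ∑ L³ (λ t → members z t * K)
        ≤⟨ ∑-mono L³ (λ t@(x₁ , x₂ , x₃) → *-monoʳ-≤ (members z t)
             (amgm-reciprocals c D
               (classSize (pair z x₁ x₂)) (classSize (pair z x₁ x₃)) (classSize (pair z x₂ x₃))
               (weight (pair z x₁ x₂)) (weight (pair z x₁ x₃)) (weight (pair z x₂ x₃))
               (classSize*weight (pair z x₁ x₂))
               (classSize*weight (pair z x₁ x₃)) (classSize*weight (pair z x₂ x₃)))) ⟩
      ∑ L³ (λ t → members z t * (classSizes z t * D + c ^ 4 * weights z t))
        ≡⟨ ∑-cong L³ (λ t → distrib (members z t) (classSizes z t) D (c ^ 4) (weights z t)) ⟩
      ∑ L³ (λ t → members z t * classSizes z t * D + c ^ 4 * (members z t * weights z t))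
        ≡⟨ ∑-distrib-+ L³ _ _ ⟩
      ∑ L³ (λ t → members z t * classSizes z t * D) + ∑ L³ (λ t → c ^ 4 * (members z t * weights z t))
        ≡⟨ cong₂ _+_ (*-distribʳ-∑ D L³ _) (*-distribˡ-∑ (c ^ 4) L³ _) ⟨
      ∑ L³ (λ t → members z t * classSizes z t) * D + c ^ 4 * ∑ L³ (λ t → members z t * weights z t)
        ≤⟨ +-mono-≤ (*-monoˡ-≤ D (∑-classSizes≤ z)) (*-monoʳ-≤ (c ^ 4) (∑-weights≤ z)) ⟩
      N ^ 5 * D + c ^ 4 * (3 * (N * weightedPairs z)) ∎

  -- The power mean inequality comes with fourth powers, while cubes are what has been bounded; the
  -- extra factor `|A|` is at most `N`.
  ∑-member⁴≤ : ∀ z → ∑ L (member z) ^ 4 ≤ N * memberTriples z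
  ∑-member⁴≤ z = *-mono-≤
    (≤-trans (∑-mono L (member≤1 z)) (≤-reflexive (trans (∑-const L 1) (*-identityʳ N))))
    (≤-reflexive (trans (cube (∑ L (member z)))
      (trans (cong (∑ L (member z) *_) (∑-*-∑ L L _ _)) (∑-*-∑ L L² _ _))))
    where
    cube : ∀ s → s ^ 3 ≡ s * (s * s)
    cube = solve 1 (λ s → s :^ 3 := s :* (s :* s)) refl

  winCount⁴≤ : winCount n f g h ^ 4 ≤ N ^ 4 * ∑ L memberTriples
  winCount⁴≤ = begin
    winCount n f g h ^ 4
      ≤⟨ ^-monoˡ-≤ 4 winCount≤ ⟩
    ∑ L (λ z → ∑ L (member z)) ^ 4
      ≤⟨ ∑⁴≤length³*∑⁴ L _ ⟩
    N ^ 3 * ∑ L (λ z → ∑ L (member z) ^ 4)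
      ≤⟨ *-monoʳ-≤ (N ^ 3) (∑-mono L ∑-member⁴≤) ⟩
    N ^ 3 * ∑ L (λ z → N * memberTriples z)
      ≡⟨ cong (N ^ 3 *_) (*-distribˡ-∑ N L memberTriples) ⟨
    N ^ 3 * (N * ∑ L memberTriples)
      ≡⟨ collect N (∑ L memberTriples) ⟩
    N ^ 4 * ∑ L memberTriples ∎
    where
    open ≤-Reasoning
    collect : ∀ N s → N ^ 3 * (N * s) ≡ N ^ 4 * s
    collect = solve 2 (λ N s → N :^ 3 :* (N :* s) := N :^ 4 :* s) refl

  winCount-bound : ∀ c → 4 * (c ^ 3 * winCount n f g h ^ 4) ≤ N ^ 10 + 3 * c ^ 4 * N ^ 7
  -- The common denominator `D`, a factorial and so nonzero, is cleared here.
  winCount-bound c = *-cancelʳ-≤ _ _ D {{length L² !≢0}} (begin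
    4 * (c ^ 3 * winCount n f g h ^ 4) * D
      ≤⟨ *-monoˡ-≤ D (*-monoʳ-≤ 4 (*-monoʳ-≤ (c ^ 3) winCount⁴≤)) ⟩
    4 * (c ^ 3 * (N ^ 4 * ∑ L memberTriples)) * D
      ≡⟨ regroup (c ^ 3) (N ^ 4) (∑ L memberTriples) D ⟩
    N ^ 4 * (4 * (c ^ 3 * D) * ∑ L memberTriples)
      ≤⟨ *-monoʳ-≤ (N ^ 4) (memberTriples-bound c) ⟩
    N ^ 4 * ((N ^ 6 + 3 * c ^ 4 * N ^ 3) * D)
      ≡⟨ collect N (c ^ 4) D ⟩
    (N ^ 10 + 3 * c ^ 4 * N ^ 7) * D ∎)
    where
    open ≤-Reasoning
    regroup : ∀ k l s D → 4 * (k * (l * s)) * D ≡ l * (4 * (k * D) * s)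
    regroup = solve-∀
    collect : ∀ N k D → N ^ 4 * ((N ^ 6 + 3 * k * N ^ 3) * D) ≡ (N ^ 10 + 3 * k * N ^ 7) * D
    collect = solve 3 (λ N k D → N :^ 4 :* ((N :^ 6 :+ con 3 :* k :* N :^ 3) :* D)
                        := (N :^ 10 :+ con 3 :* k :* N :^ 7) :* D) refl

theorem1p1 : ∃[ p ] ∃[ q ] (p ≥ 1 × q ≥ 1 ×
    ((n : ℕ) → n ≥ 1 → (f g h : Strategy n) →
    winCount n f g h ^ q * 2 ^ (p * n) ≤ 4 ^ (n * q)))
-- The fourth power of `winCount` is raised to the ninth, so `q = 36` and the value is at most
-- `2 ^ (- n / 36)`.
theorem1p1 = 1 , 36 , s≤s z≤n , s≤s z≤n , λ n _ f g h →
  exponential-decay n (winCount n f g h) (λ c →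
    subst (λ N → 4 * (c ^ 3 * winCount n f g h ^ 4) ≤ N ^ 10 + 3 * c ^ 4 * N ^ 7)
      (length-allVecs n) (Repetition.winCount-bound f g h c))
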